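{- Let $n \geq 1$ and $k \geq 1$ be integers, let $\ell = \langle \ell_1, \ell_2, \ldots, \ell_n\rangle$ be a list of $n$ distinct items in this initial order, and let $T_1 = (\Pi_\ell)^k$ be the request sequence of length $kn$ consisting of $k$ consecutive repetitions of $\Pi_\ell = \langle \ell_1, \ell_2, \ldots, \ell_n\rangle$ (the items in the same order as in the initial list). Let $C_{TRANS}(\ell, T_1)$ be the total access cost, in the full cost model, incurred by the TRANS algorithm when serving $T_1$ starting from the list $\ell$. Then: (a) if ($n$ is even and $k \leq n/2$) or ($n$ is odd and $k \leq (n-1)/2$), then $$C_{TRANS}(\ell, T_1) = k \times \left[\frac{n^2+n+k-1}{2}\right];$$ (b) if $n$ is even and $k > n/2$, then $$C_{TRANS}(\ell, T_1) = \left[\frac{n^2+2n}{2}\right] \times \left[k - \frac{1}{4}\right];$$ (c) if $n$ is odd and $k > (n-1)/2$, then $$C_{TRANS}(\ell, T_1) = \left[k \times \frac{n^2+2n-1}{2}\right] - \left[\frac{n^2-1}{8}\right].$$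
   Context: List accessing problem: one maintains an ordered list of $n$ distinct items and serves a sequence of requests $\sigma = \langle \sigma_1, \ldots, \sigma_m\rangle$, each $\sigma_i$ being an item of the list, one after another in the given order. In the full cost model, accessing the item currently in position $i$ of the list (positions counted $1, 2, \ldots, n$ from the front) costs $i$; immediately after the access, the accessed item may be moved anywhere towards the front of the list at no cost. TRANS (Transpose) algorithm: after accessing an item $x$, move $x$ forward one position by exchanging it with the item immediately preceding it in the current list (if $x$ is already at the front, the list is unchanged). This exchange is free. The total access cost is the sum of the access costs of all requests, each measured in the list configuration at the moment of that request. The list is not reset between repetitions of the permutation. Square brackets in the formulas are ordinary grouping brackets (not integer parts). -}

module Defs where

open import Data.Bool.Base using (if_then_else_)
open import Data.List.Base using (List; []; _∷_; concat; replicate)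
open import Data.Nat.Base using (ℕ; suc; _+_)
open import Relation.Binary.Definitions using (DecidableEquality)
open import Relation.Nullary.Decidable.Core using (does)

module ListAccess {a} {A : Set a} (_≟_ : DecidableEquality A) where

  -- Positions are counted from 1.  The value is meaningful only when the item
  -- occurs in the list; an absent item gets the length of the list.
  position : A → List A → ℕ
  position x []       = 0
  position x (y ∷ ys) = if does (x ≟ y) then 1 else suc (position x ys)

  transpose : A → List A → List A
  transpose x []           = []
  transpose x (y ∷ [])     = y ∷ []
  transpose x (y ∷ z ∷ zs) =
    if does (x ≟ y) then y ∷ z ∷ zs
    else if does (x ≟ z) then z ∷ y ∷ zs
    else y ∷ transpose x (z ∷ zs)

  -- Full cost model: each request pays its position in the configuration at
  -- the moment of the request; the exchange that follows is free.
  C-TRANS : List A → List A → ℕ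
  C-TRANS ℓ []      = 0
  C-TRANS ℓ (x ∷ σ) = position x ℓ + C-TRANS (transpose x ℓ) σ

open ListAccess public

infixl 8 _^^_

_^^_ : ∀ {a} {A : Set a} → List A → ℕ → List A
π ^^ k = concat (replicate k π)

{-# OPTIONS --safe #-}

-- After j passes (2j ≤ n) the list has the form M ++ y_j ∷ x_j ∷ … ∷ y_1 ∷ x_1 ∷ [], where
-- x_1 … x_j are the first j items, y_1 … y_j the last j items counted from the back, and M the
-- remaining middle block in its initial order.  During a pass the requests x_1 … x_j swap
-- every pair (y_i , x_i), the requests in M carry the front of M to its back, and
-- the requests y_j … y_1 swap every pair again.  The net effect on the list is to rotate M,
-- which turns the outer two items of M into a new pair; a block of length at most 1 is
-- unchanged.  A pass with p pairs costs (n² + n)/2 + p, so the total follows by summing over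
-- the passes.

module Submission where

open import Defs
open import Data.Integer.Base as ℤ using (+_)
open import Data.List.Base using (List; length)
open import Data.List.Relation.Unary.Unique.Propositional using (Unique)
open import Data.Nat.Base as ℕ using (ℕ; _+_; _*_; _∸_; _^_; _≤_; _>_)
open import Data.Nat.Divisibility using (_∣_)
open import Data.Product.Base using (_×_)
open import Data.Rational.Base as ℚ using (_/_)
open import Data.Sum.Base using (_⊎_)
open import Relation.Binary.Definitions using (DecidableEquality)
open import Relation.Binary.PropositionalEquality using (_≡_)
open import Relation.Nullary.Negation.Core using (¬_)
open import Data.Integer.Properties using (pos-*)
open import Data.Integer.Tactic.RingSolver renaming (solve-∀ to ℤ-solve-∀)
open import Data.List.Base using ([]; _∷_; _∷ʳ_; _++_; _ʳ++_; map; initLast; _∷ʳ′_)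
open import Data.List.Membership.Propositional.Properties using (∈-++⁺ʳ)
open import Data.List.Properties using (++-assoc; ++-identityʳ; length-++; ∷ʳ-++)
open import Data.List.Relation.Binary.Permutation.Propositional
  using (_↭_; prep; swap; ↭-refl; ↭⇒↭ₛ)
open import Data.List.Relation.Binary.Permutation.Propositional.Properties
  using (++⁺ˡ; ++⁺ʳ; ∷↭∷ʳ; ↭-length)
open import Data.List.Relation.Unary.All as All using (_∷_)
open import Data.List.Relation.Unary.AllPairs using (_∷_)
open import Data.List.Relation.Unary.Any using (here; there)
open import Data.Nat.Base using (suc; zero; _%_; s≤s; z≤n; s≤s⁻¹)
open import Data.Nat.DivMod using (m%n<n; m≡m%n+[m/n]*n; m*n/n≡m; m/n*n≡m; m/n*n≤m)
open import Data.Nat.Divisibility using (m%n≡0⇒n∣m)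
open import Data.Nat.Properties using
  (*-distribˡ-+; *-comm; *-monoˡ-≤; +-comm; +-identityʳ; +-suc; suc-injective;
   ≤-trans; ≤-reflexive; <⇒≤; m∸n≤m)
open import Data.Nat.Tactic.RingSolver using (solve-∀)
open import Data.Product.Base using (_,_; proj₁; proj₂)
open import Data.Rational.Base using (fromℚᵘ)
open import Data.Rational.Properties using
  (fromℚᵘ-cong; toℚᵘ-fromℚᵘ; toℚᵘ-injective; toℚᵘ-homo-*; toℚᵘ-homo-+; toℚᵘ-homo‿-)
open import Data.Rational.Unnormalised.Base as ℚᵘ using (mkℚᵘ; *≡*)
import Data.Rational.Unnormalised.Properties as ℚᵘ
open import Data.Sum.Base using (inj₁; inj₂)
open import Relation.Binary.PropositionalEquality
  using (_≢_; refl; sym; trans; cong; cong₂; subst; setoid; ≢-sym; module ≡-Reasoning)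
open import Relation.Nullary.Decidable using (dec-true; dec-false)
open import Relation.Nullary.Negation.Core using (contradiction)

import Data.List.Relation.Binary.Permutation.Setoid.Properties as PermutationSetoid

-- Middle block, pairs and rotation.

module _ {a} {A : Set a} where

  Unique-resp-↭ : {xs ys : List A} → xs ↭ ys → Unique xs → Unique ys
  Unique-resp-↭ p = PermutationSetoid.Unique-resp-↭ (setoid A) (↭⇒↭ₛ p)

  -- The pairs (x_i , y_i) are listed innermost first, that is in the order i = j, …, 1.
  lows highs lowHigh highLow : List (A × A) → List A
  lows  = map proj₁
  highs = map proj₂
  lowHigh []             = []
  lowHigh ((x , y) ∷ ps) = x ∷ y ∷ lowHigh ps
  highLow []             = []
  highLow ((x , y) ∷ ps) = y ∷ x ∷ highLow ps

  highLow↭lowHigh : ∀ ps → highLow ps ↭ lowHigh ps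
  highLow↭lowHigh []             = ↭-refl
  highLow↭lowHigh ((x , y) ∷ ps) = swap y x (highLow↭lowHigh ps)

  rotate : List A → List A
  rotate []       = []
  rotate (x ∷ xs) = xs ∷ʳ x

  rotate-↭ : ∀ xs → xs ↭ rotate xs
  rotate-↭ []       = ↭-refl
  rotate-↭ (x ∷ xs) = ∷↭∷ʳ x xs

  swap-unique : ∀ us {x y : A} {vs} → Unique (us ++ y ∷ x ∷ vs) → Unique (us ++ x ∷ y ∷ vs)
  swap-unique us {x} {y} = Unique-resp-↭ (++⁺ˡ us (swap y x ↭-refl))

  -- The initial list recovered from the decomposition. Pairs are stored innermost first, so only
  -- the lows need reversing: they come out as x_1, ..., x_j, while `highs ps` already reads y_j,
  -- ..., y_1.
  requests : List A → List (A × A) → List A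
  requests ms ps = lows ps ʳ++ ms ++ highs ps

  size : List A → List (A × A) → ℕ
  size ms ps = length ms + 2 * length ps

  ʳ++-++ : ∀ (xs {ys zs} : List A) → (xs ʳ++ ys) ++ zs ≡ xs ʳ++ ys ++ zs
  ʳ++-++ []       = refl
  ʳ++-++ (x ∷ xs) = ʳ++-++ xs

  length-rotate : ∀ (ms : List A) → length (rotate ms) ≡ length ms
  length-rotate ms = sym (↭-length (rotate-↭ ms))

  rotate-short : ∀ (ms : List A) → length ms ≤ 1 → rotate ms ≡ ms
  rotate-short []          _ = refl
  rotate-short (_ ∷ [])    _ = refl
  rotate-short (_ ∷ _ ∷ _) (s≤s ())

  -- A view from both ends, because the first and last items of the middle block leave it together
  -- as a new pair.
  data Peeling : List A → Set a where
    empty     : Peeling []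
    singleton : ∀ x → Peeling (x ∷ [])
    outer     : ∀ x ms y → Peeling (x ∷ ms ∷ʳ y)

  peel : ∀ ms → Peeling ms
  peel []       = empty
  peel (x ∷ ms) with initLast ms
  ... | []       = singleton x
  ... | ms ∷ʳ′ y = outer x ms y

  length-outer : ∀ (x : A) ms y → length (x ∷ ms ∷ʳ y) ≡ 2 + length ms
  length-outer x ms y = cong suc (trans (length-++ ms) (+-comm (length ms) 1))

  size-outer : ∀ x ms y ps → size (x ∷ ms ∷ʳ y) ps ≡ size ms ((x , y) ∷ ps)
  size-outer x ms y ps = trans (cong (λ l → l + 2 * length ps) (length-outer x ms y))
                               (arith (length ms) (length ps))
    where
    arith : ∀ l p → 2 + l + 2 * p ≡ l + 2 * suc p
    arith = solve-∀

  -- The birth of a pair: rotation puts x directly behind y, and `y ∷ x` is how `highLow` begins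
  -- once (x , y) heads the pairs.
  rotate-outer : ∀ (x : A) ms y vs → rotate (x ∷ ms ∷ʳ y) ++ vs ≡ ms ++ y ∷ x ∷ vs
  rotate-outer x ms y vs = trans (∷ʳ-++ (ms ∷ʳ y) x vs) (∷ʳ-++ ms y (x ∷ vs))

  -- Going inwards, x is the next low and y the next high, so pairing them leaves the request word
  -- as it was; successive passes repeat one word.
  requests-outer : ∀ x ms y ps → requests (x ∷ ms ∷ʳ y) ps ≡ requests ms ((x , y) ∷ ps)
  requests-outer x ms y ps = cong (λ σ → lows ps ʳ++ x ∷ σ) (∷ʳ-++ ms y (highs ps))

  unique-outer : ∀ x ms y ps → Unique ((x ∷ ms ∷ʳ y) ++ highLow ps) →
                 Unique (ms ++ highLow ((x , y) ∷ ps))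
  unique-outer x ms y ps uniq = subst Unique (rotate-outer x ms y (highLow ps))
    (Unique-resp-↭ (++⁺ʳ (highLow ps) (rotate-↭ (x ∷ ms ∷ʳ y))) uniq)

  unique-[] : ∀ (ℓ : List A) → Unique ℓ → Unique (ℓ ++ [])
  unique-[] ℓ = subst Unique (sym (++-identityʳ ℓ))

-- Effect and cost of a single request.

module _ {a} {A : Set a} (_≟_ : DecidableEquality A) where

  private
    cost : List A → List A → ℕ
    cost = C-TRANS _≟_

  cost-front : ∀ x vs τ → cost (x ∷ vs) (x ∷ τ) ≡ 1 + cost (x ∷ vs) τ
  cost-front x []      τ rewrite dec-true (x ≟ x) refl = refl
  cost-front x (_ ∷ _) τ rewrite dec-true (x ≟ x) refl = refl

  position-after : ∀ us {y x vs} → Unique (us ++ y ∷ x ∷ vs) →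
                   position _≟_ x (us ++ y ∷ x ∷ vs) ≡ 2 + length us
  position-after [] {y} {x} ((y≢x ∷ _) ∷ _)
    rewrite dec-false (x ≟ y) (≢-sym y≢x) | dec-true (x ≟ x) refl = refl
  position-after (u ∷ us) {y} {x} (u∉ ∷ uniq)
    rewrite dec-false (x ≟ u) (≢-sym (All.lookup u∉ (∈-++⁺ʳ us (there (here refl))))) =
    cong suc (position-after us uniq)

  transpose-skip : ∀ {x u v} vs → u ≢ x → v ≢ x →
                   transpose _≟_ x (u ∷ v ∷ vs) ≡ u ∷ transpose _≟_ x (v ∷ vs)
  transpose-skip {x} {u} {v} vs u≢x v≢x
    rewrite dec-false (x ≟ u) (≢-sym u≢x) | dec-false (x ≟ v) (≢-sym v≢x) = refl

  -- `transpose` looks at two items at once, so stepping over u also needs the item after u to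
  -- differ from x. That item is y when the prefix is a singleton, hence the extra case.
  transpose-after : ∀ us {y x vs} → Unique (us ++ y ∷ x ∷ vs) →
                    transpose _≟_ x (us ++ y ∷ x ∷ vs) ≡ us ++ x ∷ y ∷ vs
  transpose-after [] {y} {x} ((y≢x ∷ _) ∷ _)
    rewrite dec-false (x ≟ y) (≢-sym y≢x) | dec-true (x ≟ x) refl = refl
  transpose-after (u ∷ []) ((_ ∷ u≢x ∷ _) ∷ uniq@((y≢x ∷ _) ∷ _)) =
    trans (transpose-skip _ u≢x y≢x) (cong (u ∷_) (transpose-after [] uniq))
  transpose-after (u ∷ v ∷ us) (u∉ ∷ uniq@(v∉ ∷ _)) =
    trans (transpose-skip _ (All.lookup u∉ (∈-++⁺ʳ (v ∷ us) (there (here refl))))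
                            (All.lookup v∉ (∈-++⁺ʳ us (there (here refl)))))
          (cong (u ∷_) (transpose-after (v ∷ us) uniq))

  -- Apart from an access at the front, every request of a pass has this shape.
  cost-step : ∀ us {y x vs} τ → Unique (us ++ y ∷ x ∷ vs) →
              cost (us ++ y ∷ x ∷ vs) (x ∷ τ) ≡ 2 + length us + cost (us ++ x ∷ y ∷ vs) τ
  cost-step us τ uniq =
    cong₂ (λ i ℓ → i + cost ℓ τ) (position-after us uniq) (transpose-after us uniq)

  -- The phases of a pass.

  -- Reversal makes the head pair the last one requested, so it joins the prefix while the outer
  -- pairs are served. With u = `length us` the positions are u + 2, u + 4, ..., u + 2p.
  cost-lows : ∀ us ps τ → Unique (us ++ highLow ps) →
              cost (us ++ highLow ps) (lows ps ʳ++ τ) ≡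
              length ps * (length us + length ps + 1) + cost (us ++ lowHigh ps) τ
  cost-lows us []             τ uniq = refl
  cost-lows us ((x , y) ∷ ps) τ uniq = begin
    cost (us ++ y ∷ x ∷ highLow ps) (lows ps ʳ++ x ∷ τ)
      ≡⟨ cong (λ ℓ → cost ℓ (lows ps ʳ++ x ∷ τ)) (++-assoc us yx _) ⟨
    cost ((us ++ yx) ++ highLow ps) (lows ps ʳ++ x ∷ τ)
      ≡⟨ cost-lows (us ++ yx) ps (x ∷ τ) (subst Unique (sym (++-assoc us yx _)) uniq) ⟩
    p * (length (us ++ yx) + p + 1) + cost ((us ++ yx) ++ lowHigh ps) (x ∷ τ)
      ≡⟨ cong₂ (λ i ℓ → p * (i + p + 1) + cost ℓ (x ∷ τ)) (length-++ us) (++-assoc us yx _) ⟩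
    p * (length us + 2 + p + 1) + cost (us ++ y ∷ x ∷ lowHigh ps) (x ∷ τ)
      ≡⟨ cong (λ d → p * (length us + 2 + p + 1) + d) (cost-step us τ uniq′) ⟩
    p * (length us + 2 + p + 1) + (2 + length us + c)
      ≡⟨ arith p (length us) c ⟩
    suc p * (length us + suc p + 1) + c ∎
    where
    open ≡-Reasoning
    p = length ps
    yx = y ∷ x ∷ []
    c = cost (us ++ x ∷ y ∷ lowHigh ps) τ
    uniq′ = Unique-resp-↭ (++⁺ˡ us (prep y (prep x (highLow↭lowHigh ps)))) uniq
    arith : ∀ p u c → p * (u + 2 + p + 1) + (2 + u + c) ≡ suc p * (u + suc p + 1) + c
    arith = solve-∀

  -- Now the head pair is served first and then joins the prefix. In `lowHigh` each y stands where
  -- its x stood in `highLow`, so the positions are those of `cost-lows`.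
  cost-highs : ∀ us ps τ → Unique (us ++ lowHigh ps) →
               cost (us ++ lowHigh ps) (highs ps ++ τ) ≡
               length ps * (length us + length ps + 1) + cost (us ++ highLow ps) τ
  cost-highs us []             τ uniq = refl
  cost-highs us ((x , y) ∷ ps) τ uniq = begin
    cost (us ++ x ∷ y ∷ lowHigh ps) (y ∷ highs ps ++ τ)
      ≡⟨ cost-step us (highs ps ++ τ) uniq ⟩
    2 + length us + cost (us ++ y ∷ x ∷ lowHigh ps) (highs ps ++ τ)
      ≡⟨ cong (λ ℓ → 2 + length us + cost ℓ (highs ps ++ τ)) (++-assoc us yx _) ⟨
    2 + length us + cost ((us ++ yx) ++ lowHigh ps) (highs ps ++ τ)
      ≡⟨ cong (λ d → 2 + length us + d) (cost-highs (us ++ yx) ps τ uniq′) ⟩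
    2 + length us + (p * (length (us ++ yx) + p + 1) + cost ((us ++ yx) ++ highLow ps) τ)
      ≡⟨ cong₂ (λ i ℓ → 2 + length us + (p * (i + p + 1) + cost ℓ τ))
               (length-++ us) (++-assoc us yx _) ⟩
    2 + length us + (p * (length us + 2 + p + 1) + c)
      ≡⟨ arith p (length us) c ⟩
    suc p * (length us + suc p + 1) + c ∎
    where
    open ≡-Reasoning
    p = length ps
    yx = y ∷ x ∷ []
    c = cost (us ++ y ∷ x ∷ highLow ps) τ
    uniq′ = subst Unique (sym (++-assoc us yx _)) (swap-unique us uniq)
    arith : ∀ p u c → 2 + u + (p * (u + 2 + p + 1) + c) ≡ suc p * (u + suc p + 1) + c
    arith = solve-∀

  -- Each requested item stands directly behind x and exchanges places with it. The positions are u
  -- + 2, ..., u + l + 1; their sum is doubled to avoid halves.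
  cost-carry : ∀ us x ms {vs} τ → Unique (us ++ x ∷ ms ++ vs) →
               2 * cost (us ++ x ∷ ms ++ vs) (ms ++ τ) ≡
               length ms * (2 * length us + length ms + 3) + 2 * cost (us ++ ms ++ x ∷ vs) τ
  cost-carry us x []            τ uniq = refl
  cost-carry us x (m ∷ ms) {vs} τ uniq = begin
    2 * cost (us ++ x ∷ m ∷ ms ++ vs) (m ∷ ms ++ τ)
      ≡⟨ cong (2 *_) (cost-step us (ms ++ τ) uniq) ⟩
    2 * (2 + length us + cost (us ++ m ∷ x ∷ ms ++ vs) (ms ++ τ))
      ≡⟨ cong (λ ℓ → 2 * (2 + length us + cost ℓ (ms ++ τ))) (∷ʳ-++ us m _) ⟨
    2 * (2 + length us + cost (us ∷ʳ m ++ x ∷ ms ++ vs) (ms ++ τ))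
      ≡⟨ *-distribˡ-+ 2 (2 + length us) _ ⟩
    2 * (2 + length us) + 2 * cost (us ∷ʳ m ++ x ∷ ms ++ vs) (ms ++ τ)
      ≡⟨ cong (λ d → 2 * (2 + length us) + d) (cost-carry (us ∷ʳ m) x ms τ uniq′) ⟩
    2 * (2 + length us) +
      (l * (2 * length (us ∷ʳ m) + l + 3) + 2 * cost (us ∷ʳ m ++ ms ++ x ∷ vs) τ)
      ≡⟨ cong₂ (λ i ℓ → 2 * (2 + length us) + (l * (2 * i + l + 3) + 2 * cost ℓ τ))
               (length-++ us) (∷ʳ-++ us m _) ⟩
    2 * (2 + length us) + (l * (2 * (length us + 1) + l + 3) + 2 * c)
      ≡⟨ arith l (length us) c ⟩
    suc l * (2 * length us + suc l + 3) + 2 * c ∎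
    where
    open ≡-Reasoning
    l = length ms
    c = cost (us ++ m ∷ ms ++ x ∷ vs) τ
    uniq′ = subst Unique (sym (∷ʳ-++ us m _)) (swap-unique us uniq)
    arith : ∀ l u c → 2 * (2 + u) + (l * (2 * (u + 1) + l + 3) + 2 * c) ≡
                      suc l * (2 * u + suc l + 3) + 2 * c
    arith = solve-∀

  -- The first request leaves x in front; the others carry it back, and each finds its item still at
  -- its original position. The positions are 1, ..., l.
  cost-rotate : ∀ ms {vs} τ → Unique (ms ++ vs) →
                2 * cost (ms ++ vs) (ms ++ τ) ≡
                length ms * (length ms + 1) + 2 * cost (rotate ms ++ vs) τ
  cost-rotate []            τ uniq = refl
  cost-rotate (x ∷ ms) {vs} τ uniq = begin
    2 * cost (x ∷ ms ++ vs) (x ∷ ms ++ τ)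
      ≡⟨ cong (2 *_) (cost-front x (ms ++ vs) (ms ++ τ)) ⟩
    2 * (1 + cost (x ∷ ms ++ vs) (ms ++ τ))
      ≡⟨ *-distribˡ-+ 2 1 _ ⟩
    2 + 2 * cost (x ∷ ms ++ vs) (ms ++ τ)
      ≡⟨ cong (λ d → 2 + d) (cost-carry [] x ms τ uniq) ⟩
    2 + (l * (l + 3) + 2 * cost (ms ++ x ∷ vs) τ)
      ≡⟨ cong (λ ℓ → 2 + (l * (l + 3) + 2 * cost ℓ τ)) (∷ʳ-++ ms x vs) ⟨
    2 + (l * (l + 3) + 2 * c)
      ≡⟨ arith l c ⟩
    suc l * (suc l + 1) + 2 * c ∎
    where
    open ≡-Reasoning
    l = length ms
    c = cost (ms ∷ʳ x ++ vs) τ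
    arith : ∀ l c → 2 + (l * (l + 3) + 2 * c) ≡ suc l * (suc l + 1) + 2 * c
    arith = solve-∀

  -- The two pair phases undo each other on the pairs, and both cost e because rotation keeps the
  -- length of the block.
  cost-pass : ∀ ms ps τ → Unique (ms ++ highLow ps) →
              2 * cost (ms ++ highLow ps) (requests ms ps ++ τ) ≡
              size ms ps * size ms ps + size ms ps + 2 * length ps
                + 2 * cost (rotate ms ++ highLow ps) τ
  cost-pass ms ps τ uniq = begin
    2 * cost (ms ++ highLow ps) (requests ms ps ++ τ)
      ≡⟨ cong (λ σ → 2 * cost (ms ++ highLow ps) σ)
              (trans (ʳ++-++ (lows ps)) (cong (lows ps ʳ++_) (++-assoc ms _ _))) ⟩
    2 * cost (ms ++ highLow ps) (lows ps ʳ++ ms ++ highs ps ++ τ)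
      ≡⟨ cong (2 *_) (cost-lows ms ps _ uniq) ⟩
    2 * (e + cost (ms ++ lowHigh ps) (ms ++ highs ps ++ τ))
      ≡⟨ *-distribˡ-+ 2 e _ ⟩
    2 * e + 2 * cost (ms ++ lowHigh ps) (ms ++ highs ps ++ τ)
      ≡⟨ cong (λ d → 2 * e + d) (cost-rotate ms _ uniq₁) ⟩
    2 * e + (m * (m + 1) + 2 * cost (rotate ms ++ lowHigh ps) (highs ps ++ τ))
      ≡⟨ cong (λ d → 2 * e + (m * (m + 1) + 2 * d)) (cost-highs (rotate ms) ps τ uniq₂) ⟩
    2 * e + (m * (m + 1) + 2 * (p * (length (rotate ms) + p + 1) + c))
      ≡⟨ cong (λ i → 2 * e + (m * (m + 1) + 2 * (p * (i + p + 1) + c))) (length-rotate ms) ⟩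
    2 * e + (m * (m + 1) + 2 * (e + c))
      ≡⟨ arith m p c ⟩
    size ms ps * size ms ps + size ms ps + 2 * p + 2 * c ∎
    where
    open ≡-Reasoning
    m = length ms
    p = length ps
    e = p * (m + p + 1)
    c = cost (rotate ms ++ highLow ps) τ
    uniq₁ = Unique-resp-↭ (++⁺ˡ ms (highLow↭lowHigh ps)) uniq
    uniq₂ = Unique-resp-↭ (++⁺ʳ (lowHigh ps) (rotate-↭ ms)) uniq₁
    arith : ∀ m p c → 2 * (p * (m + p + 1)) + (m * (m + 1) + 2 * (p * (m + p + 1) + c)) ≡
                      (m + 2 * p) * (m + 2 * p) + (m + 2 * p) + 2 * p + 2 * c
    arith = solve-∀

  -- Repeated passes.

  run : List A → List (A × A) → ℕ → ℕ
  run ms ps k = cost (ms ++ highLow ps) (requests ms ps ^^ k)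

  -- After the pass, list and request word again come from a block and pairs, with (x , y) as the
  -- new innermost pair. The size n is a separate argument since it stays constant while block and
  -- pairs change.
  run-outer : ∀ x ms y ps k {n} → size (x ∷ ms ∷ʳ y) ps ≡ n →
              Unique ((x ∷ ms ∷ʳ y) ++ highLow ps) →
              2 * run (x ∷ ms ∷ʳ y) ps (suc k) ≡
              n * n + n + 2 * length ps + 2 * run ms ((x , y) ∷ ps) k
  run-outer x ms y ps k refl uniq = trans
    (cost-pass (x ∷ ms ∷ʳ y) ps _ uniq)
    (cong₂ (λ ℓ σ → s * s + s + 2 * length ps + 2 * cost ℓ (σ ^^ k))
           (rotate-outer x ms y (highLow ps)) (requests-outer x ms y ps))
    where s = size (x ∷ ms ∷ʳ y) ps

  -- Doubled, and with the negative terms moved to the left, so that neither division nor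
  -- truncated subtraction occurs; likewise below.
  run-growing : ∀ k ms ps {n} → k * 2 ≤ length ms → size ms ps ≡ n →
                Unique (ms ++ highLow ps) →
                2 * run ms ps k + k ≡ k * (n * n + n) + 2 * (k * length ps) + k * k
  run-growing zero    ms ps k*2≤ size≡n uniq = refl
  run-growing (suc k) ms ps k*2≤ size≡n uniq with peel ms
  -- `suc k * 2` is at least two, which excludes blocks with fewer than two items.
  run-growing (suc k) _ ps () size≡n uniq | empty
  run-growing (suc k) _ ps (s≤s ()) size≡n uniq | singleton x
  run-growing (suc k) _ ps {n} k*2≤ size≡n uniq | outer x ms y = begin
    2 * run (x ∷ ms ∷ʳ y) ps (suc k) + suc k
      ≡⟨ cong (λ d → d + suc k) (run-outer x ms y ps k size≡n uniq) ⟩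
    N + 2 * p + 2 * r + suc k
      ≡⟨ regroup (N + 2 * p) (2 * r) k ⟩
    N + 2 * p + (2 * r + k) + 1
      ≡⟨ cong (λ d → N + 2 * p + d + 1) (run-growing k ms ((x , y) ∷ ps)
           (s≤s⁻¹ (s≤s⁻¹ (subst (suc k * 2 ≤_) (length-outer x ms y) k*2≤)))
           (trans (sym (size-outer x ms y ps)) size≡n)
           (unique-outer x ms y ps uniq)) ⟩
    N + 2 * p + (k * N + 2 * (k * suc p) + k * k) + 1
      -- The new pair contributes 2k over the k later passes, completing k * k + 1 to the square of
      -- `suc k`.
      ≡⟨ arith N p k ⟩
    suc k * N + 2 * (suc k * p) + suc k * suc k ∎
    where
    open ≡-Reasoning
    N = n * n + n
    p = length ps
    r = run ms ((x , y) ∷ ps) k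
    regroup : ∀ b r k → b + r + suc k ≡ b + (r + k) + 1
    regroup = solve-∀
    arith : ∀ N p k → N + 2 * p + (k * N + 2 * (k * suc p) + k * k) + 1 ≡
                      suc k * N + 2 * (suc k * p) + suc k * suc k
    arith = solve-∀

  -- Rotation fixes such a block, so each pass ends in the list it started from.
  run-fixed : ∀ k ms ps {n} → length ms ≤ 1 → size ms ps ≡ n → Unique (ms ++ highLow ps) →
              2 * run ms ps k ≡ k * (n * n + n + 2 * length ps)
  run-fixed zero    ms ps short size≡n uniq = refl
  run-fixed (suc k) ms ps short refl uniq = trans
    (cost-pass ms ps _ uniq)
    (cong (λ d → s * s + s + 2 * length ps + d)
      (trans (cong (λ ms′ → 2 * cost (ms′ ++ highLow ps) (requests ms ps ^^ k))
                   (rotate-short ms short))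
             (run-fixed k ms ps short refl uniq)))
    where s = size ms ps

  -- After h passes all pairs are formed. Against k passes with `length ps + h` pairs each, the
  -- first h passes fall short by h, h - 1, ..., 1, and twice that sum is `h * suc h`.
  run-settled : ∀ h k ms ps {e n} → h ≤ k → length ms ≡ e + h * 2 → e ≤ 1 → size ms ps ≡ n →
                Unique (ms ++ highLow ps) →
                2 * run ms ps k + h * suc h ≡ k * (n * n + n) + 2 * (k * (length ps + h))
  run-settled zero k ms ps {e} {n} _ len e≤1 size≡n uniq = begin
    2 * run ms ps k + 0
      ≡⟨ +-identityʳ _ ⟩
    2 * run ms ps k
      ≡⟨ run-fixed k ms ps (≤-trans (≤-reflexive (trans len (+-identityʳ e))) e≤1) size≡n uniq ⟩
    k * (n * n + n + 2 * length ps)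
      ≡⟨ arith k (n * n + n) (length ps) ⟩
    k * (n * n + n) + 2 * (k * (length ps + 0)) ∎
    where
    open ≡-Reasoning
    arith : ∀ k N p → k * (N + 2 * p) ≡ k * N + 2 * (k * (p + 0))
    arith = solve-∀
  run-settled (suc h) (suc k) ms ps {e} h≤k len e≤1 size≡n uniq
    -- Since `e` is a variable, two successors have to be pulled out of the sum before the short
    -- blocks become absurd.
    with peel ms | trans len (trans (+-suc e _) (cong suc (+-suc e _)))
  ... | empty       | ()
  ... | singleton _ | ()
  run-settled (suc h) (suc k) _ ps {e} {n} (s≤s h≤k) len e≤1 size≡n uniq
    | outer x ms y | len′ = begin
    2 * run (x ∷ ms ∷ʳ y) ps (suc k) + suc h * suc (suc h)
      ≡⟨ cong (λ d → d + suc h * suc (suc h)) (run-outer x ms y ps k size≡n uniq) ⟩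
    N + 2 * p + 2 * r + suc h * suc (suc h)
      ≡⟨ regroup (N + 2 * p) (2 * r) h ⟩
    N + 2 * p + (2 * r + h * suc h) + 2 * suc h
      ≡⟨ cong (λ d → N + 2 * p + d + 2 * suc h) (run-settled h k ms ((x , y) ∷ ps) h≤k
           (suc-injective (suc-injective (trans (sym (length-outer x ms y)) len′))) e≤1
           (trans (sym (size-outer x ms y ps)) size≡n)
           (unique-outer x ms y ps uniq)) ⟩
    N + 2 * p + (k * N + 2 * (k * (suc p + h))) + 2 * suc h
      ≡⟨ arith N p k h ⟩
    suc k * N + 2 * (suc k * (p + suc h)) ∎
    where
    open ≡-Reasoning
    N = n * n + n
    p = length ps
    r = run ms ((x , y) ∷ ps) k
    regroup : ∀ b r h → b + r + suc h * suc (suc h) ≡ b + (r + h * suc h) + 2 * suc h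
    regroup = solve-∀
    arith : ∀ N p k h → N + 2 * p + (k * N + 2 * (k * (suc p + h))) + 2 * suc h ≡
                        suc k * N + 2 * (suc k * (p + suc h))
    arith = solve-∀

  -- The initial list as a block without pairs.

  run≡cost : ∀ ℓ k → run ℓ [] k ≡ cost ℓ (ℓ ^^ k)
  run≡cost ℓ k = cong₂ (λ ℓ₁ ℓ₂ → cost ℓ₁ (ℓ₂ ^^ k)) (++-identityʳ ℓ) (++-identityʳ ℓ)

  cost-growing : ∀ k ℓ {n} → length ℓ ≡ n → Unique ℓ → k * 2 ≤ n →
                 2 * cost ℓ (ℓ ^^ k) + k ≡ k * (n * n + n) + k * k
  cost-growing k ℓ {n} refl uniq k*2≤n = begin
    2 * cost ℓ (ℓ ^^ k) + k
      ≡⟨ cong (λ c → 2 * c + k) (run≡cost ℓ k) ⟨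
    2 * run ℓ [] k + k
      ≡⟨ run-growing k ℓ [] k*2≤n (+-identityʳ n) (unique-[] ℓ uniq) ⟩
    k * (n * n + n) + 2 * (k * 0) + k * k
      ≡⟨ arith k (n * n + n) ⟩
    k * (n * n + n) + k * k ∎
    where
    open ≡-Reasoning
    arith : ∀ k N → k * N + 2 * (k * 0) + k * k ≡ k * N + k * k
    arith = solve-∀

  cost-settled : ∀ k ℓ h {e n} → length ℓ ≡ n → Unique ℓ → n ≡ e + h * 2 → e ≤ 1 → h ≤ k →
                 2 * cost ℓ (ℓ ^^ k) + h * suc h ≡ k * (n * n + n) + 2 * (k * h)
  cost-settled k ℓ h {n = n} refl uniq len e≤1 h≤k = trans
    (cong (λ c → 2 * c + h * suc h) (sym (run≡cost ℓ k)))
    (run-settled h k ℓ [] h≤k len e≤1 (+-identityʳ n) (unique-[] ℓ uniq))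

-- Passage to the rational formulas.

-- By definition `fromℚᵘ (mkℚᵘ i d)` is `i / suc d`. Pulling the operations inside `fromℚᵘ` reduces
-- each formula to a cross-multiplied equation of integers.
fromℚᵘ-homo-* : ∀ p q → fromℚᵘ p ℚ.* fromℚᵘ q ≡ fromℚᵘ (p ℚᵘ.* q)
fromℚᵘ-homo-* p q = toℚᵘ-injective (ℚᵘ.≃-trans (toℚᵘ-homo-* (fromℚᵘ p) (fromℚᵘ q))
  (ℚᵘ.≃-trans (ℚᵘ.*-cong (toℚᵘ-fromℚᵘ p) (toℚᵘ-fromℚᵘ q)) (ℚᵘ.≃-sym (toℚᵘ-fromℚᵘ (p ℚᵘ.* q)))))

fromℚᵘ-homo-− : ∀ p q → fromℚᵘ p ℚ.- fromℚᵘ q ≡ fromℚᵘ (p ℚᵘ.- q)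
fromℚᵘ-homo-− p q = toℚᵘ-injective (ℚᵘ.≃-trans (toℚᵘ-homo-+ (fromℚᵘ p) (ℚ.- fromℚᵘ q))
  (ℚᵘ.≃-trans (ℚᵘ.+-cong (toℚᵘ-fromℚᵘ p)
    (ℚᵘ.≃-trans (toℚᵘ-homo‿- (fromℚᵘ q)) (ℚᵘ.-‿cong (toℚᵘ-fromℚᵘ q))))
  (ℚᵘ.≃-sym (toℚᵘ-fromℚᵘ (p ℚᵘ.- q)))))

formula-a : ∀ C n k → 2 * C + k ≡ k * (n * n + n) + k * k →
            (+ C) / 1 ≡ ((+ k) / 1) ℚ.* (((+ (n ^ 2 + n + k)) ℤ.- (+ 1)) / 2)
formula-a C n k eq = trans
  (fromℚᵘ-cong {mkℚᵘ (+ C) 0} {mkℚᵘ (+ k) 0 ℚᵘ.* mkℚᵘ ((+ Z) ℤ.- (+ 1)) 1} (*≡* (begin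
    (+ C) ℤ.* (+ 2)
      -- Adding and subtracting `k` makes room for the equation over the naturals.
      ≡⟨ expand (+ C) (+ k) ⟩
    (+ C) ℤ.* (+ 2) ℤ.+ (+ k) ℤ.- (+ k)
      ≡⟨ cong (λ i → i ℤ.+ (+ k) ℤ.- (+ k)) (pos-* C 2) ⟨
    (+ (C * 2 + k)) ℤ.- (+ k)
      ≡⟨ cong (λ i → (+ i) ℤ.- (+ k)) doubled ⟩
    (+ (k * Z)) ℤ.- (+ k)
      ≡⟨ cong (ℤ._- (+ k)) (pos-* k Z) ⟩
    (+ k) ℤ.* (+ Z) ℤ.- (+ k)
      ≡⟨ factor (+ k) (+ Z) ⟩
    (+ k) ℤ.* ((+ Z) ℤ.- (+ 1)) ℤ.* (+ 1) ∎)))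
  (sym (fromℚᵘ-homo-* (mkℚᵘ (+ k) 0) (mkℚᵘ ((+ Z) ℤ.- (+ 1)) 1)))
  where
  open ≡-Reasoning
  Z = n ^ 2 + n + k
  arith : ∀ n k → k * (n * n + n) + k * k ≡ k * (n * (n * 1) + n + k)
  arith = solve-∀
  doubled : C * 2 + k ≡ k * Z
  doubled = trans (cong (_+ k) (*-comm C 2)) (trans eq (arith n k))
  expand : ∀ c k → c ℤ.* (+ 2) ≡ c ℤ.* (+ 2) ℤ.+ k ℤ.- k
  expand = ℤ-solve-∀
  factor : ∀ k z → k ℤ.* z ℤ.- k ≡ k ℤ.* (z ℤ.- (+ 1)) ℤ.* (+ 1)
  factor = ℤ-solve-∀

-- For n = 2h, n² + 2n equals both 4h(h + 1) and n² + n + 2h, so four times the hypothesis is the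
-- equation cleared of denominators.
formula-b : ∀ C n k h → n ≡ h * 2 → 2 * C + h * suc h ≡ k * (n * n + n) + 2 * (k * h) →
            (+ C) / 1 ≡ ((+ (n ^ 2 + 2 * n)) / 2) ℚ.* (((+ k) / 1) ℚ.- ((+ 1) / 4))
formula-b C n k h n≡ eq = trans
  (fromℚᵘ-cong {mkℚᵘ (+ C) 0} {mkℚᵘ (+ Z) 1 ℚᵘ.* (mkℚᵘ (+ k) 0 ℚᵘ.- mkℚᵘ (+ 1) 3)} (*≡* (begin
    (+ C) ℤ.* (+ 8)
      ≡⟨ expand (+ C) (+ Z) ⟩
    (+ C) ℤ.* (+ 8) ℤ.+ (+ Z) ℤ.- (+ Z)
      ≡⟨ cong (λ i → i ℤ.+ (+ Z) ℤ.- (+ Z)) (pos-* C 8) ⟨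
    (+ (C * 8 + Z)) ℤ.- (+ Z)
      ≡⟨ cong (λ i → (+ i) ℤ.- (+ Z)) (eightfold h n≡ eq) ⟩
    (+ (Z * (k * 4))) ℤ.- (+ Z)
      ≡⟨ cong (ℤ._- (+ Z)) (trans (pos-* Z (k * 4)) (cong ((+ Z) ℤ.*_) (pos-* k 4))) ⟩
    (+ Z) ℤ.* ((+ k) ℤ.* (+ 4)) ℤ.- (+ Z)
      ≡⟨ factor (+ k) (+ Z) ⟩
    (+ Z) ℤ.* ((+ k) ℤ.* (+ 4) ℤ.+ (ℤ.- (+ 1)) ℤ.* (+ 1)) ℤ.* (+ 1) ∎)))
  (sym (trans (cong (((+ Z) / 2) ℚ.*_) (fromℚᵘ-homo-− (mkℚᵘ (+ k) 0) (mkℚᵘ (+ 1) 3)))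
              (fromℚᵘ-homo-* (mkℚᵘ (+ Z) 1) (mkℚᵘ (+ k) 0 ℚᵘ.- mkℚᵘ (+ 1) 3))))
  where
  open ≡-Reasoning
  Z = n ^ 2 + 2 * n
  -- Quantified anew over h and n, so that matching on `refl` replaces n by `h * 2`.
  eightfold : ∀ h {n} → n ≡ h * 2 → 2 * C + h * suc h ≡ k * (n * n + n) + 2 * (k * h) →
              C * 8 + (n ^ 2 + 2 * n) ≡ (n ^ 2 + 2 * n) * (k * 4)
  eightfold h refl eq = trans (l C h) (trans (cong (4 *_) eq) (r k h))
    where
    l : ∀ C h → C * 8 + (h * 2 * (h * 2 * 1) + 2 * (h * 2)) ≡ 4 * (2 * C + h * suc h)
    l = solve-∀
    r : ∀ k h → 4 * (k * (h * 2 * (h * 2) + h * 2) + 2 * (k * h)) ≡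
                (h * 2 * (h * 2 * 1) + 2 * (h * 2)) * (k * 4)
    r = solve-∀
  expand : ∀ c z → c ℤ.* (+ 8) ≡ c ℤ.* (+ 8) ℤ.+ z ℤ.- z
  expand = ℤ-solve-∀
  factor : ∀ k z → z ℤ.* (k ℤ.* (+ 4)) ℤ.- z ≡
                   z ℤ.* (k ℤ.* (+ 4) ℤ.+ (ℤ.- (+ 1)) ℤ.* (+ 1)) ℤ.* (+ 1)
  factor = ℤ-solve-∀

-- For n = 2h + 1, n² - 1 = 4h(h + 1) and n² + n + 2h = n² + 2n - 1. Clearing denominators takes
-- eight times the hypothesis; the extra `k * 8` and 2 absorb the two subtracted ones.
formula-c : ∀ C n k h → n ≡ 1 + h * 2 → 2 * C + h * suc h ≡ k * (n * n + n) + 2 * (k * h) →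
            (+ C) / 1 ≡ (((+ k) / 1) ℚ.* (((+ (n ^ 2 + 2 * n)) ℤ.- (+ 1)) / 2))
                          ℚ.- (((+ (n ^ 2)) ℤ.- (+ 1)) / 8)
formula-c C n k h n≡ eq = trans
  (fromℚᵘ-cong {mkℚᵘ (+ C) 0} {mkℚᵘ (+ k) 0 ℚᵘ.* mkℚᵘ X 1 ℚᵘ.- mkℚᵘ Y 7} (*≡* (begin
    (+ C) ℤ.* (+ 16)
      ≡⟨ expand (+ C) (+ k) (+ S) ⟩
    (+ C) ℤ.* (+ 16) ℤ.+ ((+ k) ℤ.* (+ 8) ℤ.+ (+ S) ℤ.* (+ 2)) ℤ.- D
      ≡⟨ cong (ℤ._- D) (cong₂ ℤ._+_ (pos-* C 16) (cong₂ ℤ._+_ (pos-* k 8) (pos-* S 2))) ⟨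
    (+ (C * 16 + (k * 8 + S * 2))) ℤ.- D
      ≡⟨ cong (λ i → (+ i) ℤ.- D) (sixteenfold h n≡ eq) ⟩
    (+ (k * Z * 8 + 2)) ℤ.- D
      ≡⟨ cong (λ i → i ℤ.+ (+ 2) ℤ.- D)
              (trans (pos-* (k * Z) 8) (cong (ℤ._* (+ 8)) (pos-* k Z))) ⟩
    (+ k) ℤ.* (+ Z) ℤ.* (+ 8) ℤ.+ (+ 2) ℤ.- D
      ≡⟨ factor (+ k) (+ Z) (+ S) ⟩
    ((+ k) ℤ.* X ℤ.* (+ 8) ℤ.+ (ℤ.- Y) ℤ.* (+ 2)) ℤ.* (+ 1) ∎)))
  (sym (trans (cong (ℚ._- (Y / 8)) (fromℚᵘ-homo-* (mkℚᵘ (+ k) 0) (mkℚᵘ X 1)))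
              (fromℚᵘ-homo-− (mkℚᵘ (+ k) 0 ℚᵘ.* mkℚᵘ X 1) (mkℚᵘ Y 7))))
  where
  open ≡-Reasoning
  Z = n ^ 2 + 2 * n
  S = n ^ 2
  X = (+ Z) ℤ.- (+ 1)
  Y = (+ S) ℤ.- (+ 1)
  D = (+ k) ℤ.* (+ 8) ℤ.+ (+ S) ℤ.* (+ 2)
  sixteenfold : ∀ h {n} → n ≡ 1 + h * 2 →
                2 * C + h * suc h ≡ k * (n * n + n) + 2 * (k * h) →
                C * 16 + (k * 8 + n ^ 2 * 2) ≡ k * (n ^ 2 + 2 * n) * 8 + 2
  sixteenfold h refl eq = trans (l C k h) (trans (cong (λ d → 8 * d + k * 8 + 2) eq) (r k h))
    where
    l : ∀ C k h → C * 16 + (k * 8 + (1 + h * 2) * ((1 + h * 2) * 1) * 2) ≡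
                  8 * (2 * C + h * suc h) + k * 8 + 2
    l = solve-∀
    r : ∀ k h → 8 * (k * ((1 + h * 2) * (1 + h * 2) + (1 + h * 2)) + 2 * (k * h)) + k * 8 + 2 ≡
                k * ((1 + h * 2) * ((1 + h * 2) * 1) + 2 * (1 + h * 2)) * 8 + 2
    r = solve-∀
  expand : ∀ c k s → c ℤ.* (+ 16) ≡ c ℤ.* (+ 16) ℤ.+ (k ℤ.* (+ 8) ℤ.+ s ℤ.* (+ 2))
                                      ℤ.- (k ℤ.* (+ 8) ℤ.+ s ℤ.* (+ 2))
  expand = ℤ-solve-∀
  factor : ∀ k z s → k ℤ.* z ℤ.* (+ 8) ℤ.+ (+ 2) ℤ.- (k ℤ.* (+ 8) ℤ.+ s ℤ.* (+ 2)) ≡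
                     (k ℤ.* (z ℤ.- (+ 1)) ℤ.* (+ 8) ℤ.+ (ℤ.- (s ℤ.- (+ 1))) ℤ.* (+ 2)) ℤ.* (+ 1)
  factor = ℤ-solve-∀

-- Parity and the three cases.

odd⇒1+[n∸1]/2*2 : ∀ {n} → ¬ (2 ∣ n) → n ≡ 1 + (n ∸ 1) ℕ./ 2 * 2
odd⇒1+[n∸1]/2*2 {n} 2∤n with n % 2 in n%2≡ | m%n<n n 2 | m≡m%n+[m/n]*n n 2
... | 0           | _            | _  = contradiction (m%n≡0⇒n∣m n 2 n%2≡) 2∤n
-- Here n ∸ 1 is `n / 2 * 2`, so halving it gives `n / 2` back.
... | 1           | _            | n≡ = trans n≡ (cong (λ q → 1 + q * 2)
  (sym (trans (cong (λ m → (m ∸ 1) ℕ./ 2) n≡) (m*n/n≡m (n ℕ./ 2) 2))))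
... | suc (suc _) | s≤s (s≤s ()) | _

theorem3p1 : ∀ {a} {A : Set a} (_≟_ : DecidableEquality A)
    (n k : ℕ) → 1 ≤ n → 1 ≤ k →
    (ℓ : List A) → length ℓ ≡ n → Unique ℓ →
    let C = (+ C-TRANS _≟_ ℓ (ℓ ^^ k)) / 1 in
    (((2 ∣ n) × (k ≤ n ℕ./ 2)) ⊎ ((¬ (2 ∣ n)) × (k ≤ (n ∸ 1) ℕ./ 2)) →
    C ≡ ((+ k) / 1) ℚ.* (((+ (n ^ 2 + n + k)) ℤ.- (+ 1)) / 2))
    ×
    ((2 ∣ n) → k > n ℕ./ 2 →
    C ≡ ((+ (n ^ 2 + 2 * n)) / 2) ℚ.* (((+ k) / 1) ℚ.- ((+ 1) / 4)))
    ×
    (¬ (2 ∣ n) → k > (n ∸ 1) ℕ./ 2 →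
    C ≡ (((+ k) / 1) ℚ.* (((+ (n ^ 2 + 2 * n)) ℤ.- (+ 1)) / 2))
    ℚ.- (((+ (n ^ 2)) ℤ.- (+ 1)) / 8))
theorem3p1 _≟_ n k _ _ ℓ len uniq =
  -- Both halves round down, so either parity yields `k * 2 ≤ n`.
  (λ { (inj₁ (_ , k≤)) → short-run (≤-trans (*-monoˡ-≤ 2 k≤) (m/n*n≤m n 2))
     ; (inj₂ (_ , k≤)) → short-run (≤-trans (*-monoˡ-≤ 2 k≤)
                                     (≤-trans (m/n*n≤m (n ∸ 1) 2) (m∸n≤m n 1))) }) ,
  -- Here h = n / 2 and e = 0; in the odd case h = (n ∸ 1) / 2 and e = 1.
  (λ { 2∣n k> → let n≡ = sym (m/n*n≡m 2∣n) in
       formula-b C n k (n ℕ./ 2) n≡ (cost-settled _≟_ k ℓ _ len uniq n≡ z≤n (<⇒≤ k>)) }) ,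
  (λ { 2∤n k> → let n≡ = odd⇒1+[n∸1]/2*2 2∤n in
       formula-c C n k ((n ∸ 1) ℕ./ 2) n≡
         (cost-settled _≟_ k ℓ _ len uniq n≡ (s≤s z≤n) (<⇒≤ k>)) })
  where
  C = C-TRANS _≟_ ℓ (ℓ ^^ k)
  short-run : k * 2 ≤ n →
    (+ C) / 1 ≡ ((+ k) / 1) ℚ.* (((+ (n ^ 2 + n + k)) ℤ.- (+ 1)) / 2)
  short-run k*2≤n = formula-a C n k (cost-growing _≟_ k ℓ len uniq k*2≤n)
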